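{- Let $\mathcal I,\mathcal J$ be ideals on $\omega$ and let $\mathcal F,\mathcal G\subseteq\omega^\omega$. If $\mathcal G$ contains the identity function, then $\mathfrak u(\mathcal I,\mathcal F,\mathcal J,\mathcal G)>|\mathcal F|$ if and only if there exists an ultrafilter $\mathcal U$ on $\omega$ such that $\mathcal I\not\le_{\mathcal F}\mathcal U^*$ and $\mathcal J\le_{\mathcal G}\mathcal U^*$.
   Context: An ideal on $\omega$ is a family of subsets of $\omega$ closed under finite unions and subsets, containing all finite sets and not containing $\omega$. Ultrafilters on $\omega$ contain all cofinite sets; $\mathcal U^*=\{\omega\setminus A:A\in\mathcal U\}$ is the dual ideal. For $\mathcal F\subseteq\omega^\omega$ and ideals $\mathcal I,\mathcal K$ on $\omega$, $\mathcal I\le_{\mathcal F}\mathcal K$ means that there is $f\in\mathcal F$ with $f^{ -1}[B]\in\mathcal K$ for every $B\in\mathcal I$. For an ideal $\mathcal K$ on $\omega$ and $\mathcal A\subseteq\mathcal P(\omega)$ let $\mathcal K(\mathcal A)=\{B\subseteq\omega:\exists F\in[\mathcal A]^{<\omega}\ (B\setminus\bigcup F\in\mathcal K)\}$; it is an ideal exactly when $\omega\notin\mathcal K(\mathcal A)$. For a cardinal $\lambda\le\mathfrak c=2^{\aleph_0}$, $\mathcal I\preceq^\lambda_{\mathcal F,\mathcal G}\mathcal J$ means: for each ideal $\mathcal J'$ on $\omega$ with $\mathcal J\le_{\mathcal G}\mathcal J'$ there exists $\mathcal A\subseteq\mathcal P(\omega)$ with $|\mathcal A|<\lambda$ such that $\omega\notin\mathcal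 J'(\mathcal A)$ and $\mathcal I\le_{\mathcal F}\mathcal J'(\mathcal A)$. Finally $$\mathfrak u(\mathcal I,\mathcal F,\mathcal J,\mathcal G)=\min\left(\{\lambda\le\mathfrak c:\mathcal I\preceq^\lambda_{\mathcal F,\mathcal G}\mathcal J\}\cup\{\mathfrak c^+\}\right).$$ -}

module Defs where

open import Axiom.ExcludedMiddle using (ExcludedMiddle) public
open import Data.List.Base using (List; foldr)
open import Data.List.Membership.Propositional using () renaming (_∈_ to _∈ˡ_)
open import Data.List.Relation.Unary.All using (All)
open import Data.Nat.Base using (ℕ)
open import Data.Product.Base using (Σ; ∃; _×_; proj₁)
open import Data.Sum.Base using (_⊎_)
open import Function.Bundles using (Func; Injection)
open import Level using (Level; 0ℓ; Setω) renaming (suc to lsuc)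
open import Relation.Binary.Bundles using (Setoid)
open import Relation.Binary.Core using (REL)
open import Relation.Binary.Definitions using (_Respectsˡ_; _Respectsʳ_)
import Relation.Binary.Construct.On as On
open import Relation.Binary.PropositionalEquality using (_→-setoid_)
open import Relation.Nullary.Negation using (¬_)
open import Relation.Unary
  using (Pred; _∈_; _∉_; _⊆_; _≐_; _∪_; _∩_; _∖_; _⊢_; ∅; U; ∁)
open import Relation.Unary.Relation.Binary.Equality using (≐-setoid)

1ℓ : Level
1ℓ = lsuc 0ℓ

-- The mathematics takes place in ZFC, so excluded middle and choice are made
-- explicit hypotheses.  A set is a setoid, so choice must produce a function
-- that respects the equalities; this is what distinguishes it from the
-- type-theoretic choice principle that is provable for Σ.

AxiomOfChoice : Setω
AxiomOfChoice =
  ∀ {a ℓ b m r} (S : Setoid a ℓ) (T : Setoid b m)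
  (R : REL (Setoid.Carrier S) (Setoid.Carrier T) r) →
  R Respectsˡ Setoid._≈_ S → R Respectsʳ Setoid._≈_ T →
  (∀ x → ∃ λ y → R x y) →
  Σ (Func S T) λ f → ∀ x → R x (Func.to f x)

𝒫ω : Set₁
𝒫ω = Pred ℕ 0ℓ

Family : Set₂
Family = Pred 𝒫ω 1ℓ

Functions : Set₂
Functions = Pred (ℕ → ℕ) 1ℓ

-- A cardinal is represented by any set of that size, and cardinals are only
-- compared through injections; equal cardinals are sets that inject into each
-- other.

Cardinal : Set₂
Cardinal = Setoid 1ℓ 0ℓ

infix 4 _≤ᶜ_ _<ᶜ_

_≤ᶜ_ : Cardinal → Cardinal → Set₁
κ ≤ᶜ μ = Injection κ μ

_<ᶜ_ : Cardinal → Cardinal → Set₁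
κ <ᶜ μ = κ ≤ᶜ μ × ¬ (μ ≤ᶜ κ)

𝔠 : Cardinal
𝔠 = ≐-setoid ℕ 0ℓ

-- Members of a family are counted up to extensional equality; the membership
-- proofs are ignored.

∣_∣ᶠᵃᵐ : Family → Cardinal
∣ 𝒜 ∣ᶠᵃᵐ = On.setoid {B = Σ 𝒫ω 𝒜} (≐-setoid ℕ 0ℓ) proj₁

∣_∣ᶠᵘⁿ : Functions → Cardinal
∣ ℱ ∣ᶠᵘⁿ = On.setoid {B = Σ (ℕ → ℕ) ℱ} (ℕ →-setoid ℕ) proj₁

IsMinimum : ∀ {ℓ} → Pred Cardinal ℓ → Cardinal → Set _
IsMinimum S κ = κ ∈ S × (∀ μ → μ ∈ S → κ ≤ᶜ μ)

IsSuccessorOf : Cardinal → Cardinal → Set₂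
IsSuccessorOf κ = IsMinimum (κ <ᶜ_)

Finite : 𝒫ω → Set
Finite A = ∃ λ xs → A ⊆ (_∈ˡ xs)

record IsIdeal (ℐ : Family) : Set₁ where
  field
    ⊆-closed  : ∀ {A B} → A ⊆ B → B ∈ ℐ → A ∈ ℐ
    ∪-closed  : ∀ {A B} → A ∈ ℐ → B ∈ ℐ → A ∪ B ∈ ℐ
    finite∈   : ∀ {A} → Finite A → A ∈ ℐ
    ω∉        : U ∉ ℐ

record IsUltrafilter (𝒰 : Family) : Set₁ where
  field
    ⊇-closed  : ∀ {A B} → A ⊆ B → A ∈ 𝒰 → B ∈ 𝒰
    ∩-closed  : ∀ {A B} → A ∈ 𝒰 → B ∈ 𝒰 → A ∩ B ∈ 𝒰
    cofinite∈ : ∀ {A} → Finite (∁ A) → A ∈ 𝒰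
    ∅∉        : ∅ ∉ 𝒰
    ultra     : ∀ A → A ∈ 𝒰 ⊎ ∁ A ∈ 𝒰

infix 8 _*

_* : Family → Family
(𝒰 *) B = ∃ λ A → A ∈ 𝒰 × B ≐ ∁ A

infix 4 _≤[_]_

_≤[_]_ : Family → Functions → Family → Set₁
ℐ ≤[ ℱ ] 𝒦 = ∃ λ f → f ∈ ℱ × (∀ B → B ∈ ℐ → f ⊢ B ∈ 𝒦)

⋃ : List 𝒫ω → 𝒫ω
⋃ = foldr _∪_ ∅

_⟨_⟩ : Family → Family → Family
(𝒦 ⟨ 𝒜 ⟩) B = ∃ λ As → All 𝒜 As × B ∖ ⋃ As ∈ 𝒦

infix 4 _⪯[_,_,_]_

_⪯[_,_,_]_ : Family → Cardinal → Functions → Functions → Family → Set₂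
ℐ ⪯[ κ , ℱ , 𝒢 ] 𝒥 =
  ∀ (𝒥′ : Family) → IsIdeal 𝒥′ → 𝒥 ≤[ 𝒢 ] 𝒥′ →
  ∃ λ (𝒜 : Family) →
    ∣ 𝒜 ∣ᶠᵃᵐ <ᶜ κ × U ∉ 𝒥′ ⟨ 𝒜 ⟩ × ℐ ≤[ ℱ ] 𝒥′ ⟨ 𝒜 ⟩

-- Is-𝔲 ℐ ℱ 𝒥 𝒢 κ says κ = 𝔲(ℐ,ℱ,𝒥,𝒢).  A predicate rather than a function
-- because the minimum of a class of cardinals is obtained classically: it
-- exists by the well-ordering theorem (the class contains 𝔠⁺), and is unique up
-- to mutual injections.

Is-𝔲 : Family → Functions → Family → Functions → Cardinal → Set₂
Is-𝔲 ℐ ℱ 𝒥 𝒢 =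
  IsMinimum λ μ → (μ ≤ᶜ 𝔠 × ℐ ⪯[ μ , ℱ , 𝒢 ] 𝒥) ⊎ IsSuccessorOf 𝔠 μ

{-# OPTIONS --safe #-}
module Submission where

-- From right to left, let 𝒰 be an ultrafilter as on the right.  The ideal 𝒰 *
-- is maximal, so a family 𝒜 with ω ∉ (𝒰 *) ⟨ 𝒜 ⟩ is contained in 𝒰 *, and
-- (𝒰 *) ⟨ 𝒜 ⟩ is just 𝒰 * (maximal-⟨⟩).  Hence 𝒰 * refutes ℐ ⪯[ κ , ℱ , 𝒢 ] 𝒥 for
-- every κ whatsoever, which leaves 𝔲 = 𝔠⁺; and ℱ has at most 𝔠 elements.
--
-- From left to right, ∣ ℱ ∣ᶠᵘⁿ ≤ᶜ 𝔠 and minimality of 𝔲 show that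
-- ℐ ⪯[ ∣ ℱ ∣ᶠᵘⁿ , ℱ , 𝒢 ] 𝒥 fails, so there is an ideal 𝒦 with 𝒥 ≤[ 𝒢 ] 𝒦 such
-- that ℐ ≤[ ℱ ] 𝒦 ⟨ 𝒜 ⟩ for no family 𝒜 of fewer than ∣ ℱ ∣ sets that keeps
-- 𝒦 ⟨ 𝒜 ⟩ proper.  Well-order ℱ so that its initial segments are smaller than ℱ
-- (small-wellOrder).  By transfinite recursion choose for each f ∈ ℱ a set B ∈ ℐ
-- whose preimage under f lies outside the ideal generated so far, and adjoin the
-- complement of that preimage, which keeps the ideal proper (diagonalise).
-- Extending the result to a maximal ideal 𝒰 * by a second recursion, along a
-- well-order of 𝒫ω (extend-to-ultrafilter), no f ∈ ℱ witnesses ℐ ≤[ ℱ ] 𝒰 *.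
--
-- Both recursions are instances of extend-along, which rests on the
-- well-ordering theorem (wellOrdering) and on transfinite dependent choice
-- (transfinite-choice).  Well-orders are taken on types with propositional
-- equality; a setoid is first replaced by a type of representatives (skeleton).

open import Defs
open import Axiom.UniquenessOfIdentityProofs.WithK using (uip)
open import Data.Empty using (⊥-elim)
open import Data.List.Base using (List; []; _∷_; _++_)
open import Data.List.Relation.Unary.All using (All; []; _∷_)
import Data.List.Relation.Unary.All as All
open import Data.List.Relation.Unary.All.Properties using (++⁺)
open import Data.Nat.Base using (ℕ; zero; suc; _*_)
open import Data.Nat.Properties using (suc-injective; *-cancelˡ-≡; even≢odd)
open import Data.Product.Base using (Σ; ∃; _×_; _,_; proj₁; proj₂)
open import Data.Sum.Base using (_⊎_; inj₁; inj₂; [_,_]′)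
import Data.Sum.Base as Sum
open import Data.Unit.Base using (tt)
import Data.Unit.Polymorphic.Base as Unit
open import Function.Base using (id; _∘_; _on_)
open import Function.Bundles using (_⇔_; mk⇔; Func; Injection; Inverse)
open import Function.Construct.Composition using () renaming (injection to _then_)
open import Function.Definitions using (Injective)
open import Function.Properties.Inverse using (Inverse⇒Injection)
import Function.Construct.Symmetry as Symmetry
open import Induction.WellFounded using (WellFounded; Acc; acc; module All; module FixPoint)
open import Level using (Level; 0ℓ; _⊔_) renaming (suc to lsuc)
open import Relation.Binary.Bundles using (Setoid)
open import Relation.Binary.Core using (Rel)
open import Relation.Binary.Definitions using (Transitive)
import Relation.Binary.Construct.On as On
open import Relation.Binary.PropositionalEquality
  using (_≡_; refl; sym; trans; cong; subst; setoid)
open import Relation.Nullary using (yes; no)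
open import Relation.Nullary.Decidable
  using (True; toWitness; fromWitness; decidable-stable)
open import Relation.Nullary.Negation using (¬_; contradiction)
open import Relation.Unary
  using (Pred; _∈_; _∉_; _⊆_; _≐_; _∪_; _∖_; _⊢_; ∅; U; ∁; ｛_｝; Satisfiable)
open import Relation.Unary.Properties using (≐-sym; ≐-trans)
open import Relation.Unary.Relation.Binary.Equality using (≐-setoid)

private
  variable
    a ℓ p v : Level

-- Well-orders

-- A strict well-order on a type, with respect to propositional equality.
-- Irreflexivity and asymmetry follow from well-foundedness.
record WellOrder (X : Set a) ℓ : Set (a ⊔ lsuc ℓ) where
  infix 4 _≺_
  field
    _≺_         : Rel X ℓ
    ≺-trans     : Transitive _≺_
    connected   : ∀ x y → x ≺ y ⊎ x ≡ y ⊎ y ≺ x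
    wellFounded : WellFounded _≺_

  -- X injects into the initial segment below b.
  EmbedsBelow : X → Set _
  EmbedsBelow b = ∃ λ (f : X → X) → Injective _≡_ _≡_ f × (∀ x → f x ≺ b)

pullback : {X : Set a} (f : X → X) → Injective _≡_ _≡_ f →
           WellOrder X ℓ → WellOrder X ℓ
pullback f f-inj W = record
  { _≺_         = _≺_ on f
  ; ≺-trans     = ≺-trans
  ; connected   = λ x y → Sum.map₂ (Sum.map₁ f-inj) (connected (f x) (f y))
  ; wellFounded = On.wellFounded f wellFounded
  }
  where open WellOrder W

-- The values S y for y ∈ D.
image : ∀ {d} {X : Set a} {V : Set v} → (X → V) → Pred X d → Pred V _
image S D A = ∃ λ y → y ∈ D × S y ≡ A

-- The ideal generated by an ideal and a family of sets

private
  variable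
    𝒦 𝒜 ℬ : Family
    A B : 𝒫ω
    As : List 𝒫ω

⟨⟩-mono : 𝒜 ⊆ ℬ → 𝒦 ⟨ 𝒜 ⟩ ⊆ 𝒦 ⟨ ℬ ⟩
⟨⟩-mono 𝒜⊆ℬ (As , As∈𝒜 , B∖As∈𝒦) = As , All.map 𝒜⊆ℬ As∈𝒜 , B∖As∈𝒦

⋃-++ˡ : ∀ As {Bs} → ⋃ As ⊆ ⋃ (As ++ Bs)
⋃-++ˡ (A ∷ As) = Sum.map₂ (⋃-++ˡ As)

⋃-++ʳ : ∀ As {Bs} → ⋃ Bs ⊆ ⋃ (As ++ Bs)
⋃-++ʳ []       n∈Bs = n∈Bs
⋃-++ʳ (A ∷ As) n∈Bs = inj₂ (⋃-++ʳ As n∈Bs)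

module Generated (𝒦-ideal : IsIdeal 𝒦) where
  open IsIdeal 𝒦-ideal

  ⟨⟩-⊆-closed : A ⊆ B → B ∈ 𝒦 ⟨ 𝒜 ⟩ → A ∈ 𝒦 ⟨ 𝒜 ⟩
  ⟨⟩-⊆-closed A⊆B (As , As∈𝒜 , B∖As∈𝒦) =
    As , As∈𝒜 , ⊆-closed (λ (n∈A , n∉As) → A⊆B n∈A , n∉As) B∖As∈𝒦

  ⟨⟩-∪-closed : A ∈ 𝒦 ⟨ 𝒜 ⟩ → B ∈ 𝒦 ⟨ 𝒜 ⟩ → A ∪ B ∈ 𝒦 ⟨ 𝒜 ⟩
  ⟨⟩-∪-closed (As , As∈𝒜 , A∖As∈𝒦) (Bs , Bs∈𝒜 , B∖Bs∈𝒦) =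
    As ++ Bs , ++⁺ As∈𝒜 Bs∈𝒜 ,
    ⊆-closed
      (λ { (inj₁ n∈A , n∉AsBs) → inj₁ (n∈A , n∉AsBs ∘ ⋃-++ˡ As)
         ; (inj₂ n∈B , n∉AsBs) → inj₂ (n∈B , n∉AsBs ∘ ⋃-++ʳ As) })
      (∪-closed A∖As∈𝒦 B∖Bs∈𝒦)

  base⊆⟨⟩ : 𝒦 ⊆ 𝒦 ⟨ 𝒜 ⟩
  base⊆⟨⟩ B∈𝒦 = [] , [] , ⊆-closed proj₁ B∈𝒦

  generator∈⟨⟩ : A ∈ 𝒜 → A ∈ 𝒦 ⟨ 𝒜 ⟩
  generator∈⟨⟩ A∈𝒜 =
    _ ∷ [] , A∈𝒜 ∷ [] ,
    finite∈ ([] , λ (n∈A , n∉A) → ⊥-elim (n∉A (inj₁ n∈A)))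

  ⟨⟩-isIdeal : U ∉ 𝒦 ⟨ 𝒜 ⟩ → IsIdeal (𝒦 ⟨ 𝒜 ⟩)
  ⟨⟩-isIdeal proper = record
    { ⊆-closed = ⟨⟩-⊆-closed
    ; ∪-closed = ⟨⟩-∪-closed
    ; finite∈  = base⊆⟨⟩ ∘ finite∈
    ; ω∉       = proper
    }

  -- Dropping the generator S costs a member of the ideal at most its part in S.
  ∖-generator : ∀ {S} → B ∈ 𝒦 ⟨ 𝒜 ∪ ｛ S ｝ ⟩ → B ∖ S ∈ 𝒦 ⟨ 𝒜 ⟩
  ∖-generator {𝒜 = 𝒜} {S} (As , As∈ , B∖As∈𝒦) =
    let Bs , Bs∈𝒜 , As⊆ = split As∈
    in Bs , Bs∈𝒜 ,
       ⊆-closed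
         (λ ((n∈B , n∉S) , n∉Bs) → n∈B , λ n∈As → [ n∉S , n∉Bs ]′ (As⊆ n∈As))
         B∖As∈𝒦
    where
    split : ∀ {As} → All (𝒜 ∪ ｛ S ｝) As → ∃ λ Bs → All 𝒜 Bs × ⋃ As ⊆ S ∪ ⋃ Bs
    split [] = [] , [] , λ ()
    split (A∈ ∷ As∈) with split As∈
    split (inj₁ A∈𝒜  ∷ _) | Bs , Bs∈𝒜 , As⊆ =
      _ ∷ Bs , A∈𝒜 ∷ Bs∈𝒜 ,
      [ inj₂ ∘ inj₁ , Sum.map₂ inj₂ ∘ As⊆ ]′
    split (inj₂ refl ∷ _) | Bs , Bs∈𝒜 , As⊆ = Bs , Bs∈𝒜 , [ inj₁ , As⊆ ]′

-- ω^ω has at most continuum many elements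

-- The pairing of x and y is 2 ^ x times the odd number 2 y + 1.
pair : ℕ → ℕ → ℕ
pair zero    y = suc (2 * y)
pair (suc x) y = 2 * pair x y

pair-injective : ∀ x x′ {y y′} → pair x y ≡ pair x′ y′ → x ≡ x′ × y ≡ y′
pair-injective zero    zero     {y} {y′} eq =
  refl , *-cancelˡ-≡ y y′ 2 (suc-injective eq)
pair-injective zero    (suc x′) {y} {y′} eq =
  contradiction (sym eq) (even≢odd (pair x′ y′) y)
pair-injective (suc x) zero     {y} {y′} eq =
  contradiction eq (even≢odd (pair x y) y′)
pair-injective (suc x) (suc x′) {y} {y′} eq =
  let x≡x′ , y≡y′ = pair-injective x x′ (*-cancelˡ-≡ (pair x y) (pair x′ y′) 2 eq)
  in cong suc x≡x′ , y≡y′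

-- A function is sent to the set of codes of the pairs in its graph.
functions≤𝔠 : (ℱ : Functions) → ∣ ℱ ∣ᶠᵘⁿ ≤ᶜ 𝔠
functions≤𝔠 ℱ = record
  { to        = graph ∘ proj₁
  ; cong      = λ f≗g → graph-mono f≗g , graph-mono (sym ∘ f≗g)
  ; injective = λ (f⊆g , _) x → f⊆g⇒f≗g f⊆g x
  }
  where
  graph : (ℕ → ℕ) → 𝒫ω
  graph f n = ∃ λ x → n ≡ pair x (f x)

  graph-mono : ∀ {f g} → (∀ x → f x ≡ g x) → graph f ⊆ graph g
  graph-mono f≗g (x , n≡) = x , trans n≡ (cong (pair x) (f≗g x))

  f⊆g⇒f≗g : ∀ {f g} → graph f ⊆ graph g → ∀ x → f x ≡ g x
  f⊆g⇒f≗g f⊆g x with f⊆g (x , refl)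
  ... | x′ , eq with refl , fx≡gx ← pair-injective x x′ eq = fx≡gx

module _ (em : ∀ {ℓ} → ExcludedMiddle ℓ) (ac : AxiomOfChoice) where

  ∁∁⊆ : ∀ (A : 𝒫ω) → ∁ (∁ A) ⊆ A
  ∁∁⊆ A = decidable-stable em

  -- The well-ordering theorem

  -- By excluded middle every proposition has an equivalent in the lowest universe.
  record Resize (P : Set ℓ) : Set where
    constructor wrap
    field unwrap : True (em {P = P})

  resize : {P : Set ℓ} → P → Resize P
  resize = wrap ∘ fromWitness

  unresize : {P : Set ℓ} → Resize P → P
  unresize = toWitness ∘ Resize.unwrap

  -- A choice function on the nonempty subsets of X adjoins to each proper subset
  -- a new element.  The subsets reached from ∅ by this step and by unions form a
  -- chain, and x is placed before y when one of them contains x but not y.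
  module Zermelo (X : Set a) where

    Subset : Set _
    Subset = Pred X 0ℓ

    private
      variable
        M N : Subset
        x y : X

    Nonempty : Setoid _ _
    Nonempty = On.setoid {B = Σ Subset Satisfiable} (≐-setoid X 0ℓ) proj₁

    choice : Σ (Func Nonempty (setoid X)) λ f → ∀ P → Func.to f P ∈ proj₁ P
    choice = ac Nonempty (setoid X) (λ P x → x ∈ proj₁ P)
      (λ P≐Q → proj₁ P≐Q) (λ { refl x∈P → x∈P }) proj₂

    choose  = proj₁ choice
    choose∈ = proj₂ choice

    -- x is the element that the choice function picks outside M.
    Next : Subset → Pred X a
    Next M x = Σ (Satisfiable (∁ M)) λ ne → Func.to choose (∁ M , ne) ≡ x

    next∉ : Next M x → x ∉ M
    next∉ {M} (ne , refl) = choose∈ (∁ M , ne)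

    next-cong : M ≐ N → Next M x → Next N y → x ≡ y
    next-cong (M⊆N , N⊆M) (_ , refl) (_ , refl) =
      Func.cong choose ((_∘ N⊆M) , (_∘ M⊆N))

    next-resp : M ≐ N → Next M x → Next N x
    next-resp {M} {N} M≐N nx@((z , z∉M) , refl) =
      (z , z∉M ∘ proj₂ M≐N) , next-cong (≐-sym M≐N) ((z , z∉M ∘ proj₂ M≐N) , refl) nx

    -- M with its next element adjoined; M itself when nothing lies outside it.
    infix 9 _⁺
    _⁺ : Subset → Subset
    (M ⁺) x = Resize (x ∈ M ⊎ Next M x)

    ⊆⁺ : M ⊆ M ⁺
    ⊆⁺ = resize ∘ inj₁

    ⁺⊆ : M ⊆ N → (∀ {x} → Next M x → x ∈ N) → M ⁺ ⊆ N
    ⁺⊆ M⊆N next⊆N x∈M⁺ = [ M⊆N , next⊆N ]′ (unresize x∈M⁺)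

    Union : Pred Subset 0ℓ → Subset
    Union 𝒬 x = Resize (∃ λ M → M ∈ 𝒬 × x ∈ M)

    -- The least family of subsets closed under _⁺ and unions.  The empty union
    -- provides the starting point.
    data Tower : Pred Subset (a ⊔ 1ℓ) where
      extend : Tower M → Tower (M ⁺)
      join   : (𝒬 : Pred Subset 0ℓ) → (∀ {M} → M ∈ 𝒬 → Tower M) → Tower (Union 𝒬)

    -- Compared by inclusion, with strict inclusion N ⊂ M sharpened to N ⁺ ⊆ M.
    Comparable : Subset → Subset → Set _
    Comparable M N = M ⊆ N ⊎ N ⁺ ⊆ M

    ⊆-unless-next : (∀ {N} → Tower N → Comparable M N) →
                    Tower N → (∀ {x} → Next M x → x ∉ N) → N ⊆ M
    ⊆-unless-next cmp (join 𝒬 t) next∉N x∈N with unresize x∈N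
    ... | N′ , N′∈𝒬 , x∈N′ =
      ⊆-unless-next cmp (t N′∈𝒬)
        (λ nx x∈N′ → next∉N nx (resize (N′ , N′∈𝒬 , x∈N′))) x∈N′
    ⊆-unless-next cmp (extend n) next∉N with cmp n
    ... | inj₂ N⁺⊆M = N⁺⊆M
    -- Here M and N coincide, so the next element of M lies in N ⁺.
    ... | inj₁ M⊆N =
      ⁺⊆ N⊆M λ nx → contradiction (resize (inj₂ nx))
                                  (next∉N (next-resp (N⊆M , M⊆N) nx))
      where N⊆M = ⊆-unless-next cmp n (λ nx → next∉N nx ∘ ⊆⁺)

    compare : Tower M → Tower N → Comparable M N
    compare {N = N} (join 𝒬 t) n with em {P = ∃ λ M → M ∈ 𝒬 × N ⁺ ⊆ M}
    ... | yes (M , M∈𝒬 , N⁺⊆M) = inj₂ λ x∈N⁺ → resize (M , M∈𝒬 , N⁺⊆M x∈N⁺)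
    ... | no none = inj₁ λ x∈⋃ →
      let M , M∈𝒬 , x∈M = unresize x∈⋃
      in [ (λ M⊆N → M⊆N x∈M) , (λ N⁺⊆M → contradiction (M , M∈𝒬 , N⁺⊆M) none) ]′
           (compare (t M∈𝒬) n)
    compare {N = N} (extend {M} m) n with compare m n
    ... | inj₂ N⁺⊆M = inj₂ (⊆⁺ ∘ N⁺⊆M)
    ... | inj₁ M⊆N with em {P = ∃ λ x → Next M x × x ∈ N}
    ...   | yes (x , nx , x∈N) =
      inj₁ (⁺⊆ M⊆N λ ny → subst N (next-cong (id , id) nx ny) x∈N)
    ...   | no none =
      inj₂ (⁺⊆ (⊆⁺ ∘ N⊆M) λ nx → resize (inj₂ (next-resp (N⊆M , M⊆N) nx)))
      where N⊆M = ⊆-unless-next (compare m) n (λ nx x∈N → none (_ , nx , x∈N))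

    -- Some tower set contains x but not y.
    infix 4 _≺_
    _≺_ : Rel X (a ⊔ 1ℓ)
    x ≺ y = ∃ λ M → Tower M × x ∈ M × y ∉ M

    ≺-trans : Transitive _≺_
    ≺-trans (M , m , x∈M , y∉M) (N , n , y∈N , z∉N) with compare m n
    ... | inj₁ M⊆N  = N , n , M⊆N x∈M , z∉N
    ... | inj₂ N⁺⊆M = contradiction (N⁺⊆M (⊆⁺ y∈N)) y∉M

    -- The least element of P is the next element of the union of all tower sets
    -- disjoint from P.
    least : {P : Pred X p} → Satisfiable P →
            ∃ λ x → x ∈ P × (∀ {y} → y ∈ P → x ≡ y ⊎ x ≺ y)
    least {P = P} (z , z∈P) = m , m∈P , before
      where
      Disjoint : Pred Subset _
      Disjoint N = Tower N × (∀ {y} → y ∈ P → y ∉ N)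

      D : Subset
      D = Union (λ N → Resize (Disjoint N))

      D-tower : Tower D
      D-tower = join _ (λ d → proj₁ (unresize d))

      P∉D : ∀ {y} → y ∈ P → y ∉ D
      P∉D y∈P y∈D with unresize y∈D
      ... | N , d , y∈N = proj₂ (unresize d) y∈P y∈N

      m : X
      m = Func.to choose (∁ D , z , P∉D z∈P)

      nm : Next D m
      nm = (z , P∉D z∈P) , refl

      m∈D⁺ : m ∈ D ⁺
      m∈D⁺ = resize (inj₂ nm)

      -- The only new element of D ⁺ is m.
      P∉D⁺ : ∀ {y} → y ∈ P → ¬ (m ≡ y) → y ∉ D ⁺
      P∉D⁺ y∈P m≢y y∈D⁺ with unresize y∈D⁺
      ... | inj₁ y∈D = P∉D y∈P y∈D
      ... | inj₂ ny  = m≢y (next-cong (id , id) nm ny)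

      -- Otherwise D ⁺ would be disjoint from P and hence contained in D.
      m∈P : m ∈ P
      m∈P = decidable-stable em λ m∉P →
        next∉ nm
          (resize (D ⁺ , resize (extend D-tower ,
                                 λ y∈P → P∉D⁺ y∈P λ { refl → m∉P y∈P }) ,
                   m∈D⁺))

      before : ∀ {y} → y ∈ P → m ≡ y ⊎ m ≺ y
      before {y} y∈P with em {P = m ≡ y}
      ... | yes m≡y = inj₁ m≡y
      ... | no  m≢y = inj₂ (D ⁺ , extend D-tower , m∈D⁺ , P∉D⁺ y∈P m≢y)

    connected : ∀ x y → x ≺ y ⊎ x ≡ y ⊎ y ≺ x
    connected x y with least {P = λ z → z ≡ x ⊎ z ≡ y} (x , inj₁ refl)
    ... | _ , inj₁ refl , before = [ inj₂ ∘ inj₁ , inj₁ ]′ (before (inj₂ refl))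
    ... | _ , inj₂ refl , before =
      [ inj₂ ∘ inj₁ ∘ sym , inj₂ ∘ inj₂ ]′ (before (inj₁ refl))

    wellFounded : WellFounded _≺_
    wellFounded x = decidable-stable em λ ¬acc →
      let z , ¬acc-z , before = least {P = λ y → ¬ Acc _≺_ y} (x , ¬acc)
      in ¬acc-z (acc λ y≺z → decidable-stable em λ ¬acc-y →
           irreflexive
             ([ (λ { refl → y≺z }) , (λ z≺y → ≺-trans z≺y y≺z) ]′ (before ¬acc-y)))
      where
      irreflexive : ∀ {x} → ¬ (x ≺ x)
      irreflexive (_ , _ , x∈M , x∉M) = x∉M x∈M

  -- Only the existence of the order matters, so the construction is sealed.
  abstract
    wellOrdering : (X : Set a) → WellOrder X (a ⊔ 1ℓ)
    wellOrdering X = record { Zermelo X }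

  -- If X embeds below some b, take b least and transport the order along the
  -- embedding.
  small-wellOrder : (X : Set a) →
    Σ (WellOrder X (a ⊔ 1ℓ)) λ W → ∀ b → ¬ WellOrder.EmbedsBelow W b
  small-wellOrder X with em {P = ∃ (WellOrder.EmbedsBelow (wellOrdering X))}
  ... | no  none      = wellOrdering X , λ b b-emb → none (b , b-emb)
  ... | yes (b , emb) =
    All.wfRec wellFounded _ (λ b → EmbedsBelow b → Small) descend b emb
    where
    open WellOrder (wellOrdering X)

    Small : Set _
    Small = Σ (WellOrder X _) λ W → ∀ b → ¬ WellOrder.EmbedsBelow W b

    descend : ∀ b → (∀ {c} → c ≺ b → EmbedsBelow c → Small) → EmbedsBelow b → Small
    descend b ih (f , f-inj , f≺b) with em {P = ∃ λ c → c ≺ b × EmbedsBelow c}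
    ... | yes (c , c≺b , c-emb) = ih c≺b c-emb
    ... | no none =
      pullback f f-inj (wellOrdering X) ,
      λ c (g , g-inj , fg≺fc) →
        none (f c , f≺b c , f ∘ g , g-inj ∘ f-inj , fg≺fc)

  -- Transfinite dependent choice: an element S x that is Good for x and for the
  -- set of earlier choices can be chosen for all x at once, if it exists whenever
  -- the earlier choices were good.  The value v₀ is a default.
  module _ {X : Set a} {V : Set v} (W : WellOrder X ℓ) (v₀ : V) where
    open WellOrder W

    earlier : X → (X → V) → Pred V (a ⊔ v ⊔ ℓ)
    earlier x S = image S (_≺ x)

    transfinite-choice :
      (Good : X → Pred V (a ⊔ v ⊔ ℓ) → V → Set p) →
      (∀ {x 𝒜 ℬ s} → 𝒜 ≐ ℬ → Good x 𝒜 s → Good x ℬ s) →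
      (∀ x S → (∀ {y} → y ≺ x → Good y (earlier y S) (S y)) →
       ∃ (Good x (earlier x S))) →
      ∃ λ S → ∀ x → Good x (earlier x S) (S x)
    transfinite-choice Good resp exists = S , S-good
      where
      -- The choice respects equality of sets of values, so the recursion depends
      -- only on the values of its recursive calls, as unfolding it requires.
      choice : ∀ x → Σ (Func (≐-setoid V _) (setoid V)) λ f →
               ∀ 𝒜 → Satisfiable (Good x 𝒜) → Good x 𝒜 (Func.to f 𝒜)
      choice x =
        ac _ _ (λ 𝒜 s → Satisfiable (Good x 𝒜) → Good x 𝒜 s)
          (λ 𝒜≐ℬ good (s , s-good) → resp 𝒜≐ℬ (good (s , resp (≐-sym 𝒜≐ℬ) s-good)))
          (λ { refl good → good })
          total
        where
        total : ∀ 𝒜 → ∃ λ s → Satisfiable (Good x 𝒜) → Good x 𝒜 s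
        total 𝒜 with em {P = Satisfiable (Good x 𝒜)}
        ... | yes (s , s-good) = s , λ _ → s-good
        ... | no none          = v₀ , λ s → contradiction s none

      pick : X → Func (≐-setoid V _) (setoid V)
      pick x = proj₁ (choice x)

      pick-good : ∀ x 𝒜 → Satisfiable (Good x 𝒜) → Good x 𝒜 (Func.to (pick x) 𝒜)
      pick-good x = proj₂ (choice x)

      values : ∀ {x} → (∀ {y} → y ≺ x → V) → Pred V _
      values {x} rec A = ∃ λ y → Σ (y ≺ x) λ y≺x → rec y≺x ≡ A

      step : ∀ x → (∀ {y} → y ≺ x → V) → V
      step x rec = Func.to (pick x) (values rec)

      step-ext : ∀ x {rec rec′ : ∀ {y} → y ≺ x → V} →
                 (∀ {y} (y≺x : y ≺ x) → rec y≺x ≡ rec′ y≺x) →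
                 step x rec ≡ step x rec′
      step-ext x rec≗rec′ = Func.cong (pick x)
        ( (λ (y , y≺x , eq) → y , y≺x , trans (sym (rec≗rec′ y≺x)) eq)
        , (λ (y , y≺x , eq) → y , y≺x , trans (rec≗rec′ y≺x) eq) )

      S : X → V
      S = All.wfRec wellFounded _ (λ _ → V) step

      S-unfold : ∀ x → S x ≡ Func.to (pick x) (earlier x S)
      S-unfold x = FixPoint.unfold-wfRec wellFounded (λ _ → V) step step-ext

      S-good : ∀ x → Good x (earlier x S) (S x)
      S-good = All.wfRec wellFounded _ _ λ x ih →
        subst (Good x _) (sym (S-unfold x)) (pick-good x _ (exists x S ih))

  -- Proper extensions of an ideal along a well-order

  module _ (𝒦-ideal : IsIdeal 𝒦) {X : Set₁} (W : WellOrder X 1ℓ) where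
    open IsIdeal 𝒦-ideal
    open WellOrder W

    -- Properness has finite character: a nonempty finite subfamily of the image
    -- of D comes from indices that have a greatest element y ∈ D, and the empty
    -- one generates only 𝒦.
    image-proper : ∀ {D : Pred X 1ℓ} (S : X → 𝒫ω) →
      (∀ {y} → y ∈ D → U ∉ 𝒦 ⟨ image S (_≺ y) ∪ ｛ S y ｝ ⟩) →
      U ∉ 𝒦 ⟨ image S D ⟩
    image-proper {D} S proper (As , As∈ , U∖As∈𝒦) =
      [ (λ { refl → ω∉ (⊆-closed (λ _ → tt , λ ()) U∖As∈𝒦) })
      , (λ (y , y∈D , As∈y) → proper y∈D (As , As∈y , U∖As∈𝒦)) ]′ (bound As∈)
      where
      upTo : X → Family
      upTo y = image S (_≺ y) ∪ ｛ S y ｝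

      upTo-mono : ∀ {y z} → y ≺ z → upTo y ⊆ upTo z
      upTo-mono y≺z (inj₁ (x , x≺y , eq)) = inj₁ (x , ≺-trans x≺y y≺z , eq)
      upTo-mono y≺z (inj₂ eq)             = inj₁ (_ , y≺z , eq)

      bound : ∀ {As} → All (image S D) As → As ≡ [] ⊎ ∃ λ y → y ∈ D × All (upTo y) As
      bound [] = inj₁ refl
      bound ((z , z∈D , eq) ∷ As∈) with bound As∈
      ... | inj₁ refl = inj₂ (z , z∈D , inj₂ eq ∷ [])
      ... | inj₂ (y , y∈D , As∈y) with connected z y
      ...   | inj₁ z≺y         = inj₂ (y , y∈D , inj₁ (z , z≺y , eq) ∷ As∈y)
      ...   | inj₂ (inj₁ refl) = inj₂ (y , y∈D , inj₂ eq ∷ As∈y)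
      ...   | inj₂ (inj₂ y≺z)  =
        inj₂ (z , z∈D , inj₂ eq ∷ All.map (upTo-mono y≺z) As∈y)

    -- If at each x some set with property P x can be adjoined properly to the
    -- earlier ones, then all of X can be served simultaneously.
    extend-along : (P : X → 𝒫ω → Set₁) →
      (∀ x S → U ∉ 𝒦 ⟨ image S (_≺ x) ⟩ →
       ∃ λ A → P x A × U ∉ 𝒦 ⟨ image S (_≺ x) ∪ ｛ A ｝ ⟩) →
      ∃ λ S → (∀ x → P x (S x)) × U ∉ 𝒦 ⟨ image S U ⟩
    extend-along P adjoin =
      let S , good = transfinite-choice W ∅
            (λ x 𝒜 A → P x A × U ∉ 𝒦 ⟨ 𝒜 ∪ ｛ A ｝ ⟩)
            (λ 𝒜≐ℬ (PA , proper) → PA , proper ∘ ⟨⟩-mono {𝒦 = 𝒦} (Sum.map₁ (proj₂ 𝒜≐ℬ)))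
            (λ x S good → adjoin x S (image-proper S (proj₂ ∘ good)))
      in S , proj₁ ∘ good ,
         λ (As , As∈ , U∖As∈𝒦) →
           image-proper {D = λ _ → Unit.⊤} S (λ {y} _ → proj₂ (good y))
             (As , All.map (λ (y , _ , eq) → y , _ , eq) As∈ , U∖As∈𝒦)

  -- Ultrafilters and their dual ideals

  ∈* : ∀ {𝒰 : Family} → ∁ B ∈ 𝒰 → B ∈ 𝒰 *
  ∈* {B} ∁B∈𝒰 = ∁ B , ∁B∈𝒰 , (λ n∈B n∉B → n∉B n∈B) , ∁∁⊆ B

  ∈*⁻ : ∀ {𝒰} → IsUltrafilter 𝒰 → B ∈ 𝒰 * → ∁ B ∈ 𝒰
  ∈*⁻ 𝒰-ultra (A , A∈𝒰 , B⊆∁A , _) = ⊇-closed (λ n∈A n∈B → B⊆∁A n∈B n∈A) A∈𝒰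
    where open IsUltrafilter 𝒰-ultra

  *-isIdeal : ∀ {𝒰} → IsUltrafilter 𝒰 → IsIdeal (𝒰 *)
  *-isIdeal 𝒰-ultra = record
    { ⊆-closed = λ A⊆B B∈ → ∈* (⊇-closed (_∘ A⊆B) (∈*⁻ 𝒰-ultra B∈))
    ; ∪-closed = λ A∈ B∈ → ∈*
        (⊇-closed (λ (n∉A , n∉B) → [ n∉A , n∉B ]′)
                  (∩-closed (∈*⁻ 𝒰-ultra A∈) (∈*⁻ 𝒰-ultra B∈)))
    ; finite∈  = λ {A} (xs , A⊆xs) → ∈* (cofinite∈ (xs , A⊆xs ∘ ∁∁⊆ A))
    ; ω∉       = λ U∈ → ∅∉ (⊇-closed (λ n∉U → n∉U tt) (∈*⁻ 𝒰-ultra U∈))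
    }
    where open IsUltrafilter 𝒰-ultra

  -- A generator outside 𝒰 * would have its complement in 𝒰 *.
  maximal-⟨⟩ : ∀ {𝒰} → IsUltrafilter 𝒰 → U ∉ (𝒰 *) ⟨ 𝒜 ⟩ → (𝒰 *) ⟨ 𝒜 ⟩ ⊆ 𝒰 *
  maximal-⟨⟩ {𝒜} {𝒰} 𝒰-ultra proper {B} (As , As∈𝒜 , B∖As∈𝒰*) =
    ⊆-closed cover (∪-closed (⋃∈ As∈𝒜) B∖As∈𝒰*)
    where
    open IsUltrafilter 𝒰-ultra
    open IsIdeal (*-isIdeal 𝒰-ultra)

    𝒜⊆𝒰* : 𝒜 ⊆ 𝒰 *
    𝒜⊆𝒰* {A} A∈𝒜 with ultra A
    ... | inj₂ ∁A∈𝒰 = ∈* ∁A∈𝒰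
    ... | inj₁ A∈𝒰  = contradiction
      (A ∷ [] , A∈𝒜 ∷ [] , ⊆-closed (λ (_ , n∉A) → n∉A ∘ inj₁) (A , A∈𝒰 , id , id))
      proper

    ⋃∈ : ∀ {As} → All 𝒜 As → ⋃ As ∈ 𝒰 *
    ⋃∈ []            = finite∈ ([] , λ ())
    ⋃∈ (A∈𝒜 ∷ As∈𝒜) = ∪-closed (𝒜⊆𝒰* A∈𝒜) (⋃∈ As∈𝒜)

    cover : B ⊆ ⋃ As ∪ (B ∖ ⋃ As)
    cover {n} n∈B with em {P = n ∈ ⋃ As}
    ... | yes n∈As = inj₁ n∈As
    ... | no  n∉As = inj₂ (n∈B , n∉As)

  -- One of A and ∁ A is adjoined for each A; if both made the ideal improper, it
  -- would contain U ∖ A and U ∖ ∁ A, hence be improper already.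
  extend-to-ultrafilter : IsIdeal 𝒦 → ∃ λ 𝒰 → IsUltrafilter 𝒰 × 𝒦 ⊆ 𝒰 *
  extend-to-ultrafilter {𝒦} 𝒦-ideal =
    𝒰 , 𝒰-ultra , λ {B} B∈𝒦 → ∈* (⊆-closed (∁∁⊆ B) (base⊆⟨⟩ B∈𝒦))
    where
    open Generated 𝒦-ideal
    open WellOrder (wellOrdering 𝒫ω)

    adjoin : ∀ A S → U ∉ 𝒦 ⟨ image S (_≺ A) ⟩ →
      ∃ λ B → (A ≡ B ⊎ ∁ A ≡ B) × U ∉ 𝒦 ⟨ image S (_≺ A) ∪ ｛ B ｝ ⟩
    adjoin A S proper with em {P = U ∈ 𝒦 ⟨ image S (_≺ A) ∪ ｛ A ｝ ⟩}
                         | em {P = U ∈ 𝒦 ⟨ image S (_≺ A) ∪ ｛ ∁ A ｝ ⟩}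
    ... | no  A-proper | _            = A   , inj₁ refl , A-proper
    ... | yes _        | no ∁A-proper = ∁ A , inj₂ refl , ∁A-proper
    ... | yes A-total  | yes ∁A-total = contradiction
      (⟨⟩-⊆-closed cover (⟨⟩-∪-closed (∖-generator A-total) (∖-generator ∁A-total)))
      proper
      where
      cover : U ⊆ (U ∖ A) ∪ (U ∖ ∁ A)
      cover {n} _ with em {P = n ∈ A}
      ... | yes n∈A = inj₂ (tt , λ n∉A → n∉A n∈A)
      ... | no  n∉A = inj₁ (tt , n∉A)

    extension : ∃ λ S → (∀ A → A ≡ S A ⊎ ∁ A ≡ S A) × U ∉ 𝒦 ⟨ image S U ⟩
    extension = extend-along 𝒦-ideal (wellOrdering 𝒫ω)
                  (λ A B → A ≡ B ⊎ ∁ A ≡ B) adjoin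

    S      = proj₁ extension
    S-spec = proj₁ (proj₂ extension)
    proper = proj₂ (proj₂ extension)

    ℳ : Family
    ℳ = 𝒦 ⟨ image S U ⟩

    open IsIdeal (⟨⟩-isIdeal proper)

    𝒰 : Family
    𝒰 A = ∁ A ∈ ℳ

    𝒰-ultra : IsUltrafilter 𝒰
    𝒰-ultra = record
      { ⊇-closed  = λ A⊆B → ⊆-closed (_∘ A⊆B)
      ; ∩-closed  = λ {A} {B} A∈ B∈ → ⊆-closed (de-morgan A B) (∪-closed A∈ B∈)
      ; cofinite∈ = finite∈
      ; ∅∉        = λ ∁∅∈ → ω∉ (⊆-closed (λ _ ()) ∁∅∈)
      ; ultra     = ultra
      }
      where
      de-morgan : ∀ (A B : 𝒫ω) {n} → ¬ (A n × B n) → ¬ A n ⊎ ¬ B n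
      de-morgan A B {n} ¬both with em {P = A n}
      ... | yes n∈A = inj₂ λ n∈B → ¬both (n∈A , n∈B)
      ... | no  n∉A = inj₁ n∉A

      ultra : ∀ A → A ∈ 𝒰 ⊎ ∁ A ∈ 𝒰
      ultra A with S-spec A
      ... | inj₁ A≡SA  = inj₂ (⊆-closed (∁∁⊆ A) (generator∈⟨⟩ (A , tt , sym A≡SA)))
      ... | inj₂ ∁A≡SA = inj₁ (generator∈⟨⟩ (A , tt , sym ∁A≡SA))

  -- Diagonalisation against a set of functions

  -- Every setoid is isomorphic to a type with propositional equality, namely a
  -- type of representatives of its classes.
  skeleton : (T : Setoid a ℓ) → Σ (Set a) λ X → Inverse T (setoid X)
  skeleton {a = a} T = Rep , record
    { to        = λ x → r x , r-cong (T.sym (≈r x))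
    ; from      = proj₁
    ; to-cong   = λ x≈y → Rep-≡ (r-cong x≈y)
    ; from-cong = λ { refl → T.refl }
    ; inverse   = (λ { {_ , ry≡y} x≈y → Rep-≡ (trans (r-cong x≈y) ry≡y) })
                , (λ { {x} refl → T.sym (≈r x) })
    }
    where
    module T = Setoid T
    open Setoid T using (Carrier; _≈_)

    representatives : Σ (Func T (setoid Carrier)) λ f → ∀ x → x ≈ Func.to f x
    representatives = ac T (setoid Carrier) _≈_
      (λ x≈x′ x≈y → T.trans (T.sym x≈x′) x≈y) (λ { refl x≈y → x≈y })
      (λ x → x , T.refl)

    open Func (proj₁ representatives) using () renaming (to to r; cong to r-cong)
    ≈r = proj₂ representatives

    Rep : Set a
    Rep = ∃ λ x → r x ≡ x

    Rep-≡ : {x y : Rep} → proj₁ x ≡ proj₁ y → x ≡ y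
    Rep-≡ {x , p} {.x , q} refl = cong (x ,_) (uip p q)

  -- ℱ is enumerated by a well-ordered type X that does not embed into any of its
  -- initial segments.
  module Diagonalisation {ℐ : Family} {ℱ : Functions} (𝒦-ideal : IsIdeal 𝒦)
    (unbounded : ∀ 𝒜 → ∣ 𝒜 ∣ᶠᵃᵐ <ᶜ ∣ ℱ ∣ᶠᵘⁿ → U ∉ 𝒦 ⟨ 𝒜 ⟩ → ¬ (ℐ ≤[ ℱ ] 𝒦 ⟨ 𝒜 ⟩))
    (X : Set₁) (ℱ≅X : Inverse ∣ ℱ ∣ᶠᵘⁿ (setoid X))
    (W : WellOrder X 1ℓ) (no-embedding : ∀ b → ¬ WellOrder.EmbedsBelow W b)
    where

    open Generated 𝒦-ideal
    open WellOrder W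

    ℱ≤X : Injection ∣ ℱ ∣ᶠᵘⁿ (setoid X)
    ℱ≤X = Inverse⇒Injection ℱ≅X

    X≤ℱ : Injection (setoid X) ∣ ℱ ∣ᶠᵘⁿ
    X≤ℱ = Inverse⇒Injection (Symmetry.inverse ℱ≅X)

    -- The function in ℱ with index x.
    fun : X → ℕ → ℕ
    fun x = proj₁ (Inverse.from ℱ≅X x)

    -- An embedding of ℱ into the sets chosen before x, composed with a choice of
    -- an index for each of them, would embed X below x.
    earlier-small : ∀ x S → ∣ image S (_≺ x) ∣ᶠᵃᵐ <ᶜ ∣ ℱ ∣ᶠᵘⁿ
    earlier-small x S = seg≤X then X≤ℱ , λ ℱ≤seg →
      let open Injection (X≤ℱ then (ℱ≤seg then seg≤X))
      in no-embedding x
           (to , injective ,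
            λ y → proj₁ (index-spec (Injection.to (X≤ℱ then ℱ≤seg) y)))
      where
      seg : Setoid 1ℓ 0ℓ
      seg = ∣ image S (_≺ x) ∣ᶠᵃᵐ

      indexing : Σ (Func seg (setoid X)) λ f →
                 ∀ A → Func.to f A ≺ x × proj₁ A ≐ S (Func.to f A)
      indexing = ac seg (setoid X) (λ A y → y ≺ x × proj₁ A ≐ S y)
        (λ A≐B (y≺x , A≐Sy) → y≺x , ≐-trans (≐-sym A≐B) A≐Sy)
        (λ { refl spec → spec })
        (λ { (_ , y , y≺x , refl) → y , y≺x , id , id })

      index-spec = proj₂ indexing

      seg≤X : Injection seg (setoid X)
      seg≤X = record
        { to        = Func.to (proj₁ indexing)
        ; cong      = Func.cong (proj₁ indexing)
        ; injective = λ {A} {B} fA≡fB →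
            ≐-trans (subst (λ y → proj₁ A ≐ S y) fA≡fB (proj₂ (index-spec A)))
                    (≐-sym (proj₂ (index-spec B)))
        }

    -- S defeats f when it is the complement of the preimage under f of a member
    -- of ℐ: a proper ideal that contains S cannot contain that preimage.
    Defeats : (ℕ → ℕ) → 𝒫ω → Set₁
    Defeats f S = ∃ λ B → B ∈ ℐ × S ≡ ∁ (f ⊢ B)

    defeat : ∀ x S → U ∉ 𝒦 ⟨ image S (_≺ x) ⟩ →
      ∃ λ A → Defeats (fun x) A × U ∉ 𝒦 ⟨ image S (_≺ x) ∪ ｛ A ｝ ⟩
    defeat x S proper
      with em {P = ∃ λ B → B ∈ ℐ × fun x ⊢ B ∉ 𝒦 ⟨ image S (_≺ x) ⟩}
    ... | yes (B , B∈ℐ , f⊢B∉) =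
      ∁ (fun x ⊢ B) , (B , B∈ℐ , refl) ,
      λ total → f⊢B∉ (⟨⟩-⊆-closed (λ n∈ → tt , λ n∉ → n∉ n∈) (∖-generator total))
    ... | no none = contradiction
      (fun x , proj₂ (Inverse.from ℱ≅X x) ,
       λ B B∈ℐ → decidable-stable em λ f⊢B∉ → none (B , B∈ℐ , f⊢B∉))
      (unbounded (image S (_≺ x)) (earlier-small x S) proper)

    ultrafilter : ∃ λ 𝒰 → IsUltrafilter 𝒰 × 𝒦 ⊆ 𝒰 * × ¬ (ℐ ≤[ ℱ ] 𝒰 *)
    ultrafilter with extend-along 𝒦-ideal W (Defeats ∘ fun) defeat
    ... | S , defeats , proper
      with extend-to-ultrafilter (⟨⟩-isIdeal proper)
    ...   | 𝒰 , 𝒰-ultra , ⊆𝒰* = 𝒰 , 𝒰-ultra , ⊆𝒰* ∘ base⊆⟨⟩ , not-≤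
      where
      open IsIdeal (*-isIdeal 𝒰-ultra)

      not-≤ : ¬ (ℐ ≤[ ℱ ] 𝒰 *)
      not-≤ (f , f∈ℱ , f⊢∈) with defeats (Inverse.to ℱ≅X (f , f∈ℱ))
      ... | B , B∈ℐ , S≡ =
        ω∉ (⊆-closed cover
             (∪-closed (f⊢∈ B B∈ℐ) (⊆𝒰* (generator∈⟨⟩ (_ , tt , S≡)))))
        where
        -- The representative of f, which agrees with f pointwise.
        f′ = fun (Inverse.to ℱ≅X (f , f∈ℱ))

        f′≗f : ∀ n → f′ n ≡ f n
        f′≗f = Inverse.inverseʳ ℱ≅X refl

        cover : U ⊆ (f ⊢ B) ∪ ∁ (f′ ⊢ B)
        cover {n} _ with em {P = B (f n)}
        ... | yes fn∈B = inj₁ fn∈B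
        ... | no  fn∉B = inj₂ (fn∉B ∘ subst B (f′≗f n))

  -- A base ideal from which fewer than ∣ ℱ ∣ generators never reach ℐ ≤[ ℱ ] _
  -- extends to a maximal ideal that does not reach it either.
  diagonalise : {ℐ : Family} {ℱ : Functions} → IsIdeal 𝒦 →
    (∀ 𝒜 → ∣ 𝒜 ∣ᶠᵃᵐ <ᶜ ∣ ℱ ∣ᶠᵘⁿ → U ∉ 𝒦 ⟨ 𝒜 ⟩ → ¬ (ℐ ≤[ ℱ ] 𝒦 ⟨ 𝒜 ⟩)) →
    ∃ λ 𝒰 → IsUltrafilter 𝒰 × 𝒦 ⊆ 𝒰 * × ¬ (ℐ ≤[ ℱ ] 𝒰 *)
  diagonalise {ℱ = ℱ} 𝒦-ideal unbounded =
    let X , ℱ≅X          = skeleton ∣ ℱ ∣ᶠᵘⁿ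
        W , no-embedding = small-wellOrder X
    in Diagonalisation.ultrafilter 𝒦-ideal unbounded X ℱ≅X W no-embedding

≤[]-mono : ∀ {ℐ ℱ} 𝒦 ℒ → 𝒦 ⊆ ℒ → ℐ ≤[ ℱ ] 𝒦 → ℐ ≤[ ℱ ] ℒ
≤[]-mono 𝒦 ℒ 𝒦⊆ℒ (f , f∈ℱ , f⊢∈) = f , f∈ℱ , λ B B∈ℐ → 𝒦⊆ℒ (f⊢∈ B B∈ℐ)

theorem3p4 : (∀ {ℓ} → ExcludedMiddle ℓ) → AxiomOfChoice →
    (ℐ 𝒥 : Family) → IsIdeal ℐ → IsIdeal 𝒥 →
    (ℱ 𝒢 : Functions) → id ∈ 𝒢 →
    (𝔲 : Cardinal) → Is-𝔲 ℐ ℱ 𝒥 𝒢 𝔲 →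
    (∣ ℱ ∣ᶠᵘⁿ <ᶜ 𝔲) ⇔
    (∃ λ (𝒰 : Family) → IsUltrafilter 𝒰 × ¬ (ℐ ≤[ ℱ ] 𝒰 *) × (𝒥 ≤[ 𝒢 ] 𝒰 *))
theorem3p4 em ac ℐ 𝒥 _ _ ℱ 𝒢 _ 𝔲 (𝔲∈ , 𝔲-least) = mk⇔ ⇒ ⇐
  where
  Witness : Set₂
  Witness = ∃ λ (𝒰 : Family) → IsUltrafilter 𝒰 × ¬ (ℐ ≤[ ℱ ] 𝒰 *) × (𝒥 ≤[ 𝒢 ] 𝒰 *)

  ⇒ : ∣ ℱ ∣ᶠᵘⁿ <ᶜ 𝔲 → Witness
  ⇒ (_ , 𝔲≰ℱ) = decidable-stable em λ no-witness →
    𝔲≰ℱ (𝔲-least _ (inj₁ (functions≤𝔠 ℱ , λ 𝒦 𝒦-ideal 𝒥≤𝒦 →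
      decidable-stable em λ no-𝒜 →
        let 𝒰 , 𝒰-ultra , 𝒦⊆𝒰* , ℐ≰𝒰* =
              diagonalise em ac 𝒦-ideal
                (λ 𝒜 small proper ℐ≤ → no-𝒜 (𝒜 , small , proper , ℐ≤))
        in no-witness (𝒰 , 𝒰-ultra , ℐ≰𝒰* , ≤[]-mono 𝒦 (𝒰 *) 𝒦⊆𝒰* 𝒥≤𝒦))))

  ⇐ : Witness → ∣ ℱ ∣ᶠᵘⁿ <ᶜ 𝔲
  ⇐ (𝒰 , 𝒰-ultra , ℐ≰𝒰* , 𝒥≤𝒰*) = [ bounded , successor ]′ 𝔲∈
    where
    -- This case is impossible.
    bounded : 𝔲 ≤ᶜ 𝔠 × ℐ ⪯[ 𝔲 , ℱ , 𝒢 ] 𝒥 → ∣ ℱ ∣ᶠᵘⁿ <ᶜ 𝔲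
    bounded (_ , ℐ⪯𝒥) =
      let 𝒜 , _ , proper , ℐ≤ = ℐ⪯𝒥 (𝒰 *) (*-isIdeal em ac 𝒰-ultra) 𝒥≤𝒰*
      in contradiction
           (≤[]-mono ((𝒰 *) ⟨ 𝒜 ⟩) (𝒰 *) (maximal-⟨⟩ em ac 𝒰-ultra proper) ℐ≤)
           ℐ≰𝒰*

    successor : IsSuccessorOf 𝔠 𝔲 → ∣ ℱ ∣ᶠᵘⁿ <ᶜ 𝔲
    successor ((𝔠≤𝔲 , 𝔲≰𝔠) , _) =
      functions≤𝔠 ℱ then 𝔠≤𝔲 , λ 𝔲≤ℱ → 𝔲≰𝔠 (𝔲≤ℱ then functions≤𝔠 ℱ)
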